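{- Let $\mathbb{F}$ be a field of characteristic zero. Suppose that $g(x) = g_0 + g_rx^r + g_{r+1}x^{r+1} + \cdots \in \mathbb{F}[[x]]$ with $r \geq 1$ and $g_r \neq 0$. Let $a(x) = a_sx^s + a_{s+1}x^{s+1} + \cdots$ and $b(x) = b_sx^s + b_{s+1}x^{s+1} + \cdots$ be elements of $\mathbb{F}[[x]]$, where $s \geq 1$ and $a_s = b_s \neq 0$. Then $$g\big(a(x)\big) = g\big(b(x)\big) \implies a(x) = b(x).$$
   Context: $\mathbb{F}[[x]]$ is the ring of formal power series over $\mathbb{F}$. There is no assumption that $g(x)$ has a compositional inverse. -}

module Defs where

open import Algebra.Apartness.Bundles using (HeytingField; HeytingCommutativeRing)
open import Algebra.Bundles using (CommutativeRing)
import Algebra.Properties.Semiring.Mult as SemiringMult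
import Algebra.Properties.CommutativeMonoid.Sum as CommutativeMonoidSum
open import Data.Fin.Base using (Fin; zero; suc; toℕ; fromℕ; inject₁)
open import Data.Fin.Properties using (toℕ-fromℕ; toℕ-inject₁)
open import Data.Nat.Base as ℕ using (ℕ; zero; suc; _∸_; _≤_; _<_; z≤n; s≤s)
import Data.Nat.Properties as ℕₚ
open import Relation.Binary.PropositionalEquality.Core as ≡ using ()
import Relation.Binary.Reasoning.Setoid as SetoidReasoning
open import Relation.Nullary.Negation.Core using (¬_)

fieldRing : ∀ {c ℓ₁ ℓ₂} → HeytingField c ℓ₁ ℓ₂ → CommutativeRing c ℓ₁
fieldRing F = HeytingCommutativeRing.commutativeRing (HeytingField.heytingCommutativeRing F)

CharacteristicZero : ∀ {c ℓ} → CommutativeRing c ℓ → Set ℓ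
CharacteristicZero R = ∀ n → ¬ (suc n × 1# ≈ 0#)
  where
  open CommutativeRing R
  open SemiringMult semiring using (_×_)

module FormalPowerSeries {c ℓ} (R : CommutativeRing c ℓ) where

  open CommutativeRing R
  open CommutativeMonoidSum +-commutativeMonoid
    using (sum⁺-syntax; sum-init-last; sum-cong-≋; sum-replicate-zero)

  infix  4 _≋_
  infixl 7 _⊛_
  infixr 8 _^_
  infixl 9 _⟨_⟩

  -- f stands for Σₙ f(n) xⁿ.
  PowerSeries : Set c
  PowerSeries = ℕ → Carrier

  _≋_ : PowerSeries → PowerSeries → Set ℓ
  f ≋ g = ∀ n → f n ≈ g n

  1ₚ : PowerSeries
  1ₚ zero    = 1#
  1ₚ (suc _) = 0#

  _⊛_ : PowerSeries → PowerSeries → PowerSeries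
  (f ⊛ g) n = ∑[ i ≤ n ] (f (toℕ i) * g (n ∸ toℕ i))

  _^_ : PowerSeries → ℕ → PowerSeries
  f ^ zero  = 1ₚ
  f ^ suc k = f ⊛ f ^ k

  -- g ⟨ a ⟩ is g(a(x)) = Σₖ gₖ a(x)ᵏ, meaningful only when a has zero
  -- constant term. In that case aᵏ has no xⁿ term for k > n, so the
  -- coefficient of xⁿ is the finite sum over k ≤ n; see ⟨⟩-stable.
  _⟨_⟩ : PowerSeries → PowerSeries → PowerSeries
  (g ⟨ a ⟩) n = ∑[ k ≤ n ] (g (toℕ k) * (a ^ toℕ k) n)

  ^-vanishes : ∀ a → a 0 ≈ 0# → ∀ {k n} → n < k → (a ^ k) n ≈ 0#
  ^-vanishes a a₀≈0 {suc k} {n} (s≤s n≤k) =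
    trans (sum-cong-≋ {suc n} term≈0) (sum-replicate-zero (suc n))
    where
    term≈0 : ∀ (i : Fin (suc n)) → a (toℕ i) * (a ^ k) (n ∸ toℕ i) ≈ 0#
    term≈0 zero = trans (*-congʳ a₀≈0) (zeroˡ _)
    term≈0 (suc {suc m} i) =
      trans (*-congˡ (^-vanishes a a₀≈0 (ℕₚ.≤-trans (s≤s (ℕₚ.m∸n≤m m (toℕ i))) n≤k)))
            (zeroʳ _)

  -- Every partial sum Σ_{k ≤ N} gₖ aᵏ with N ≥ n has the same xⁿ coefficient.
  ⟨⟩-stable : ∀ g a → a 0 ≈ 0# → ∀ {n N} → n ≤ N →
              ∑[ k ≤ N ] (g (toℕ k) * (a ^ toℕ k) n) ≈ (g ⟨ a ⟩) n
  ⟨⟩-stable g a a₀≈0 {n} n≤N = go (ℕₚ.≤⇒≤′ n≤N)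
    where
    open SetoidReasoning setoid

    term : ℕ → Carrier
    term k = g k * (a ^ k) n

    go : ∀ {N} → n ℕ.≤′ N → ∑[ k ≤ N ] term (toℕ k) ≈ (g ⟨ a ⟩) n
    go (ℕ.≤′-reflexive ≡.refl) = refl
    go (ℕ.≤′-step {N} n≤′N) = begin
      ∑[ k ≤ suc N ] term (toℕ k)
        ≈⟨ sum-init-last {suc N} (λ k → term (toℕ k)) ⟩
      ∑[ k ≤ N ] term (toℕ (inject₁ k)) + term (toℕ (fromℕ (suc N)))
        ≈⟨ +-cong (sum-cong-≋ {suc N} (λ k → reflexive (≡.cong term (toℕ-inject₁ k))))
                  (reflexive (≡.cong term (toℕ-fromℕ (suc N)))) ⟩
      ∑[ k ≤ N ] term (toℕ k) + term (suc N)
        ≈⟨ +-cong (go n≤′N)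
                  (trans (*-congˡ (^-vanishes a a₀≈0 (s≤s (ℕₚ.≤′⇒≤ n≤′N)))) (zeroʳ _)) ⟩
      (g ⟨ a ⟩) n + 0#
        ≈⟨ +-identityʳ _ ⟩
      (g ⟨ a ⟩) n ∎

{-# OPTIONS --safe #-}

-- Suppose a and b agree below degree m = s + e, and let d = aₘ - bₘ and
-- α = aₛ = bₛ. Then aᵏ - bᵏ vanishes below degree ks + e, where its
-- coefficient is k αᵏ⁻¹ d. In degree rs + e, therefore, only the term k = r
-- contributes to g(a) - g(b), and equating coefficients gives
-- gᵣ r αʳ⁻¹ d = 0, so d = 0. Strong induction on m finishes the proof.

module Submission where

open import Defs
open import Algebra.Apartness.Bundles using (HeytingField)
open import Algebra.Bundles using (CommutativeRing)
import Algebra.Apartness.Properties.HeytingCommutativeRing as HeytingProperties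
import Algebra.Properties.CommutativeMonoid.Sum as CommutativeMonoidSum
import Algebra.Properties.Group as GroupProperties
import Algebra.Properties.Semiring.Exp as SemiringExp
import Algebra.Properties.Semiring.Mult as SemiringMult
open import Data.Fin.Base using (toℕ; fromℕ<; punchIn)
open import Data.Fin.Properties using (toℕ-fromℕ<; toℕ-injective; toℕ≤pred[n]; punchInᵢ≢i)
open import Data.Nat.Base as ℕ using (ℕ; zero; suc; _∸_; _≤_; _<_; s≤s; z≤n)
open import Data.Nat.Induction using (<-rec)
import Data.Nat.Properties as ℕₚ
import Data.Nat.Solver as ℕ-Solver
open import Data.Product.Base using (_,_; proj₁)
open import Data.Vec.Functional using (removeAt)
open import Level using (Level)
open import Relation.Binary.Definitions using (tri<; tri≈; tri>)
open import Relation.Binary.PropositionalEquality.Core as ≡ using (_≡_; _≢_)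
import Relation.Binary.Reasoning.Setoid as SetoidReasoning
open import Relation.Nullary.Decidable.Core using (yes; no)
open import Relation.Nullary.Negation.Core using (¬_; contradiction)

module LeadingCoefficients {c ℓ} (R : CommutativeRing c ℓ) where

  open CommutativeRing R
  open FormalPowerSeries R
  open CommutativeMonoidSum +-commutativeMonoid
  open SemiringMult semiring using (_×_; ×-congʳ; ×-comm-*)
  open SemiringExp semiring using () renaming (_^_ to _↑_)
  open GroupProperties +-group using (identityʳ-unique)
  open SetoidReasoning setoid

  -- Finite sums with at most one nonzero term

  sum≈0 : ∀ {n} {t} → (∀ i → t i ≈ 0#) → sum {n} t ≈ 0#
  sum≈0 {n} t≈0 = trans (sum-cong-≋ t≈0) (sum-replicate-zero n)

  -- Isolates the top coefficient of a product and, later, the index `r` in the expansion of g(a) -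
  -- g(b).
  sum-single : ∀ {m j} (t : ℕ → Carrier) → j ≤ m →
               (∀ {i} → i ≤ m → i ≢ j → t i ≈ 0#) →
               ∑[ i ≤ m ] t (toℕ i) ≈ t j
  sum-single {m} {j} t j≤m t≈0 = begin
    ∑[ i ≤ m ] t (toℕ i)           ≈⟨ sum-remove {m} {k} t′ ⟩
    t′ k + sum (removeAt t′ k)     ≈⟨ +-cong (reflexive (≡.cong t k≡j)) (sum≈0 rest≈0) ⟩
    t j + 0#                       ≈⟨ +-identityʳ (t j) ⟩
    t j                            ∎
    where
    k = fromℕ< (s≤s j≤m)
    k≡j = toℕ-fromℕ< (s≤s j≤m)
    t′ = λ i → t (toℕ i)

    rest≈0 : ∀ i → removeAt t′ k i ≈ 0#
    rest≈0 i = t≈0 (toℕ≤pred[n] (punchIn k i))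
      (λ eq → punchInᵢ≢i k i (toℕ-injective (≡.trans eq (≡.sym k≡j))))

  -- Leading terms of sums, products and powers

  -- f = c xᵖ + higher terms; c may be zero.
  record Leading (f : PowerSeries) (p : ℕ) (c : Carrier) : Set ℓ where
    field
      below : ∀ {i} → i < p → f i ≈ 0#
      at    : f p ≈ c

  open Leading

  Leading-resp-≡ : ∀ {f p q c} → p ≡ q → Leading f p c → Leading f q c
  Leading-resp-≡ ≡.refl F = F

  Leading-+ : ∀ {f g p c d} → Leading f p c → Leading g p d →
              Leading (λ n → f n + g n) p (c + d)
  Leading-+ F G .below i<p = trans (+-cong (below F i<p) (below G i<p)) (+-identityʳ 0#)
  Leading-+ F G .at        = +-cong (at F) (at G)

  -- If `i + j < p + q`, then `i < p` or `j < q`, so each product of coefficients has a zero factor.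
  -- If `i + j` equals `p + q`, the only other possibility is `i = p`, `j = q`.
  Leading-⊛ : ∀ {f g p q c d} → Leading f p c → Leading g q d →
              Leading (f ⊛ g) (p ℕ.+ q) (c * d)
  Leading-⊛ {f} {g} {p} {q} {c} {d} F G = record { below = vanish ; at = top }
    where
    left≈0 : ∀ {i j} → i < p → f i * g j ≈ 0#
    left≈0 i<p = trans (*-congʳ (below F i<p)) (zeroˡ _)

    right≈0 : ∀ {i j} → j < q → f i * g j ≈ 0#
    right≈0 j<q = trans (*-congˡ (below G j<q)) (zeroʳ _)

    vanish : ∀ {n} → n < p ℕ.+ q → (f ⊛ g) n ≈ 0#
    vanish {n} n<p+q = sum≈0 {suc n} (λ i → term (toℕ i) (toℕ≤pred[n] i))
      where
      term : ∀ i → i ≤ n → f i * g (n ∸ i) ≈ 0#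
      term i i≤n with i ℕₚ.<? p
      ... | yes i<p = left≈0 i<p
      -- Here `p ≤ i`, so `n ∸ i < p + q ∸ i ≤ q`.
      ... | no  i≮p = right≈0 (ℕₚ.<-≤-trans (ℕₚ.∸-monoˡ-< n<p+q i≤n)
        (ℕₚ.≤-trans (ℕₚ.∸-monoʳ-≤ (p ℕ.+ q) (ℕₚ.≮⇒≥ i≮p)) (ℕₚ.≤-reflexive (ℕₚ.m+n∸m≡n p q))))

    top : (f ⊛ g) (p ℕ.+ q) ≈ c * d
    top = begin
      (f ⊛ g) (p ℕ.+ q)         ≈⟨ sum-single (λ i → f i * g (p ℕ.+ q ∸ i)) (ℕₚ.m≤m+n p q) term ⟩
      f p * g (p ℕ.+ q ∸ p)     ≡⟨ ≡.cong (λ j → f p * g j) (ℕₚ.m+n∸m≡n p q) ⟩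
      f p * g q                 ≈⟨ *-cong (at F) (at G) ⟩
      c * d                     ∎
      where
      term : ∀ {i} → i ≤ p ℕ.+ q → i ≢ p → f i * g (p ℕ.+ q ∸ i) ≈ 0#
      term {i} i≤p+q i≢p with ℕₚ.<-cmp i p
      ... | tri< i<p _ _ = left≈0 i<p
      ... | tri≈ _ i≡p _ = contradiction i≡p i≢p
      ... | tri> _ _ p<i = right≈0
        (≡.subst (p ℕ.+ q ∸ i <_) (ℕₚ.m+n∸m≡n p q) (ℕₚ.∸-monoʳ-< p<i i≤p+q))

  Leading-^ : ∀ {f p c} → Leading f p c → ∀ k → Leading (f ^ k) (k ℕ.* p) (c ↑ k)
  Leading-^ F zero    = record { below = λ () ; at = refl }
  Leading-^ F (suc k) = Leading-⊛ F (Leading-^ F k)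

  -- Increments of powers and their leading terms

  -- aᵏ - bᵏ for a = b + h, from aᵏ⁺¹ - bᵏ⁺¹ = h aᵏ + b (aᵏ - bᵏ).
  ^-increment : (a b h : PowerSeries) → ℕ → PowerSeries
  ^-increment a b h zero    n = 0#
  ^-increment a b h (suc k) n = (h ⊛ a ^ k) n + (b ⊛ ^-increment a b h k) n

  -- Induction on `k` from `(b + h) aᵏ = b (bᵏ + E) + h aᵏ`, expanded termwise under the convolution
  -- sum.
  ^-increment-correct : ∀ {a b h} → (∀ n → a n ≈ b n + h n) →
                        ∀ k n → (a ^ k) n ≈ (b ^ k) n + ^-increment a b h k n
  ^-increment-correct a≈b+h zero n = sym (+-identityʳ _)
  ^-increment-correct {a} {b} {h} a≈b+h (suc k) n = begin
    (a ⊛ a ^ k) n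
      ≈⟨ sum-cong-≋ {suc n} (λ i → split (toℕ i) (n ∸ toℕ i)) ⟩
    ∑[ i ≤ n ] (bb (toℕ i) + (ha (toℕ i) + bE (toℕ i)))
      ≈⟨ ∑-distrib-+ {suc n} (λ i → bb (toℕ i)) (λ i → ha (toℕ i) + bE (toℕ i)) ⟩
    (b ⊛ b ^ k) n + ∑[ i ≤ n ] (ha (toℕ i) + bE (toℕ i))
      ≈⟨ +-congˡ (∑-distrib-+ {suc n} (λ i → ha (toℕ i)) (λ i → bE (toℕ i))) ⟩
    (b ⊛ b ^ k) n + ((h ⊛ a ^ k) n + (b ⊛ E) n)
      ∎
    where
    E = ^-increment a b h k
    bb ha bE : ℕ → Carrier
    bb i = b i * (b ^ k) (n ∸ i)
    ha i = h i * (a ^ k) (n ∸ i)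
    bE i = b i * E (n ∸ i)

    split : ∀ i j → a i * (a ^ k) j ≈ b i * (b ^ k) j + (h i * (a ^ k) j + b i * E j)
    split i j = begin
      a i * (a ^ k) j
        ≈⟨ *-congʳ (a≈b+h i) ⟩
      (b i + h i) * (a ^ k) j
        ≈⟨ distribʳ _ _ _ ⟩
      b i * (a ^ k) j + h i * (a ^ k) j
        ≈⟨ +-congʳ (*-congˡ (^-increment-correct a≈b+h k j)) ⟩
      b i * ((b ^ k) j + E j) + h i * (a ^ k) j
        ≈⟨ +-congʳ (distribˡ _ _ _) ⟩
      b i * (b ^ k) j + b i * E j + h i * (a ^ k) j
        ≈⟨ +-assoc _ _ _ ⟩
      b i * (b ^ k) j + (b i * E j + h i * (a ^ k) j)
        ≈⟨ +-congˡ (+-comm _ _) ⟩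
      b i * (b ^ k) j + (h i * (a ^ k) j + b i * E j)
        ∎

  -- k αᵏ⁻¹ d, by a recursion that avoids the exponent k - 1.
  ^-slope : (α d : Carrier) → ℕ → Carrier
  ^-slope α d zero    = 0#
  ^-slope α d (suc k) = d * α ↑ k + α * ^-slope α d k

  -- The extra factor `α` raises the exponent from `k - 1` to `k`, so the closed form also makes
  -- sense at `k = 0`.
  *-^-slope : ∀ α d k → α * ^-slope α d k ≈ k × (α ↑ k * d)
  *-^-slope α d zero    = zeroʳ α
  *-^-slope α d (suc k) = begin
    α * (d * α ↑ k + α * ^-slope α d k)
      ≈⟨ distribˡ _ _ _ ⟩
    α * (d * α ↑ k) + α * (α * ^-slope α d k)
      ≈⟨ +-cong (*-congˡ (*-comm _ _)) (*-congˡ (*-^-slope α d k)) ⟩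
    α * (α ↑ k * d) + α * (k × (α ↑ k * d))
      ≈⟨ +-cong (*-assoc _ _ _) (trans (×-congʳ k (*-assoc _ _ _)) (sym (×-comm-* k _ _))) ⟨
    α ↑ suc k * d + k × (α ↑ suc k * d)
      ∎

  -- Both summands of the recursion, `h aᵏ` and `b` times the previous increment, start at degree
  -- `(k + 1) s + e` or later; their coefficients there are the two summands of `^-slope`.
  Leading-^-increment : ∀ {a b h s e α d} →
    Leading a s α → Leading b s α → Leading h (s ℕ.+ e) d →
    ∀ k → Leading (^-increment a b h k) (k ℕ.* s ℕ.+ e) (^-slope α d k)
  Leading-^-increment A B H zero = record { below = λ _ → refl ; at = refl }
  Leading-^-increment {s = s} {e} A B H (suc k) = Leading-+
    (Leading-resp-≡
      (solve 3 (λ s e x → s :+ e :+ x := s :+ x :+ e) ≡.refl s e (k ℕ.* s))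
      (Leading-⊛ H (Leading-^ A k)))
    (Leading-resp-≡
      (≡.sym (ℕₚ.+-assoc s (k ℕ.* s) e))
      (Leading-⊛ B (Leading-^-increment A B H k)))
    where open ℕ-Solver.+-*-Solver

  -- Comparison of the coefficients of g(a) and g(b)

  ⟨⟩-increment : ∀ g {a b h} → (∀ n → a n ≈ b n + h n) → ∀ n →
    (g ⟨ a ⟩) n ≈ (g ⟨ b ⟩) n + ∑[ k ≤ n ] (g (toℕ k) * ^-increment a b h (toℕ k) n)
  ⟨⟩-increment g {a} {b} {h} a≈b+h n = trans
    (sum-cong-≋ {suc n} (λ k →
      trans (*-congˡ {g (toℕ k)} (^-increment-correct a≈b+h (toℕ k) n)) (distribˡ _ _ _)))
    (∑-distrib-+ {suc n} (λ k → g (toℕ k) * (b ^ toℕ k) n)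
                         (λ k → g (toℕ k) * ^-increment a b h (toℕ k) n))

  gᵣ*slope≈0 : ∀ {g r a b h s e α d} .{{_ : ℕ.NonZero s}} →
    (∀ i → 1 ≤ i → i < r → g i ≈ 0#) →
    (∀ n → a n ≈ b n + h n) →
    Leading a s α → Leading b s α → Leading h (s ℕ.+ e) d →
    g ⟨ a ⟩ ≋ g ⟨ b ⟩ → g r * ^-slope α d r ≈ 0#
  gᵣ*slope≈0 {g} {r} {a} {b} {h} {s} {e} {α} {d} g≈0 a≈b+h A B H ga≈gb = begin
    g r * ^-slope α d r      ≈⟨ *-congˡ (at (E r)) ⟨
    term r                   ≈⟨ sum-single term r≤N others ⟨
    -- The `N`-th coefficients of g(a) and g(b) agree and differ by this sum.
    ∑[ k ≤ N ] term (toℕ k)  ≈⟨ identityʳ-unique _ _ (trans (sym (⟨⟩-increment g a≈b+h N)) (ga≈gb N)) ⟩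
    0#                       ∎
    where
    N = r ℕ.* s ℕ.+ e
    E = Leading-^-increment A B H

    term : ℕ → Carrier
    term k = g k * ^-increment a b h k N

    -- The coefficient at `N` only sums over `k ≤ N`; `s ≥ 1` puts `r` in that range.
    r≤N : r ≤ N
    r≤N = ℕₚ.≤-trans (ℕₚ.m≤m*n r s) (ℕₚ.m≤m+n (r ℕ.* s) e)

    others : ∀ {k} → k ≤ N → k ≢ r → term k ≈ 0#
    -- The constant term of g cancels, as the increment of the zeroth power is zero.
    others {zero}  _ _ = zeroʳ _
    others {suc k} _ k≢r with ℕₚ.<-cmp (suc k) r
    ... | tri< k<r _ _ = trans (*-congʳ (g≈0 (suc k) (s≤s z≤n) k<r)) (zeroˡ _)
    ... | tri≈ _ k≡r _ = contradiction k≡r k≢r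
    -- The increment starts at degree `k s + e` or later, which exceeds `N` because `s ≥ 1`.
    ... | tri> _ _ r<k = trans
      (*-congˡ (below (E (suc k)) (ℕₚ.+-monoˡ-< e (ℕₚ.*-monoˡ-< s r<k)))) (zeroʳ _)

-- Cancellation of nonzero factors in a Heyting field

module HeytingFieldCancellation {c ℓ₁ ℓ₂} (F : HeytingField c ℓ₁ ℓ₂) where

  open HeytingField F
  open HeytingProperties heytingCommutativeRing using (x-0≈x)
  open CommutativeRing (fieldRing F) using (semiring)
  open SemiringMult semiring using (_×_; ×-congʳ; ×-assoc-*)
  open SemiringExp semiring using (_^_)

  -- By tightness it suffices to refute y # 0#, so only y is ever inverted
  -- and x need not be apart from 0#.
  x≉0∧xy≈0⇒y≈0 : ∀ {x y} → ¬ (x ≈ 0#) → x * y ≈ 0# → y ≈ 0#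
  x≉0∧xy≈0⇒y≈0 {x} {y} x≉0 xy≈0 = proj₁ (tight y 0#) λ y#0 →
    let y⁻¹ , _ , yy⁻¹≈1 = #⇒invertible y#0 in
    x≉0 (begin
      x                       ≈⟨ *-identityʳ x ⟨
      x * 1#                  ≈⟨ *-congˡ yy⁻¹≈1 ⟨
      x * ((y - 0#) * y⁻¹)    ≈⟨ *-congˡ (*-congʳ (x-0≈x y)) ⟩
      x * (y * y⁻¹)           ≈⟨ *-assoc x y y⁻¹ ⟨
      x * y * y⁻¹             ≈⟨ *-congʳ xy≈0 ⟩
      0# * y⁻¹                ≈⟨ zeroˡ y⁻¹ ⟩
      0#                      ∎)
    where open SetoidReasoning setoid

  x≉0∧xᵏy≈0⇒y≈0 : ∀ {x y} → ¬ (x ≈ 0#) → ∀ k → x ^ k * y ≈ 0# → y ≈ 0#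
  x≉0∧xᵏy≈0⇒y≈0 x≉0 zero    y≈0  = trans (sym (*-identityˡ _)) y≈0
  x≉0∧xᵏy≈0⇒y≈0 x≉0 (suc k) xy≈0 =
    x≉0∧xᵏy≈0⇒y≈0 x≉0 k (x≉0∧xy≈0⇒y≈0 x≉0 (trans (sym (*-assoc _ _ _)) xy≈0))

  -- Rewriting `n × x` as `(n × 1#) * x` exposes a factor that is nonzero in characteristic zero.
  n×x≈0⇒x≈0 : CharacteristicZero (fieldRing F) →
              ∀ {x} n .{{_ : ℕ.NonZero n}} → n × x ≈ 0# → x ≈ 0#
  n×x≈0⇒x≈0 char0 {x} n@(suc m) nx≈0 = x≉0∧xy≈0⇒y≈0 (char0 m)
    (trans (×-assoc-* n 1# x) (trans (×-congʳ n (*-identityˡ x)) nx≈0))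

-- Strong induction on the degree

theorem2p5 : {c ℓ₁ ℓ₂ : Level} (F : HeytingField c ℓ₁ ℓ₂) →
    let open HeytingField F
        open FormalPowerSeries (fieldRing F)
    in
    CharacteristicZero (fieldRing F) →
    (g : PowerSeries) (r : ℕ) → 1 ≤ r →
    (∀ i → 1 ≤ i → i < r → g i ≈ 0#) → ¬ (g r ≈ 0#) →
    (a b : PowerSeries) (s : ℕ) → 1 ≤ s →
    (∀ i → i < s → a i ≈ 0#) → (∀ i → i < s → b i ≈ 0#) →
    a s ≈ b s → ¬ (a s ≈ 0#) →
    g ⟨ a ⟩ ≋ g ⟨ b ⟩ → a ≋ b
theorem2p5 F char0 g r 1≤r g≈0 gᵣ≉0 a b s 1≤s a≈0 b≈0 aₛ≈bₛ aₛ≉0 ga≈gb = <-rec _ step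
  where
  open CommutativeRing (fieldRing F)
  open LeadingCoefficients (fieldRing F)
  open HeytingFieldCancellation F
  open GroupProperties +-group using (x∙y⁻¹≈ε⇒x≈y; x≈y⇒x∙y⁻¹≈ε; //-rightDividesˡ)

  instance
    r≢0 : ℕ.NonZero r
    r≢0 = ℕ.>-nonZero 1≤r

    s≢0 : ℕ.NonZero s
    s≢0 = ℕ.>-nonZero 1≤s

  step : ∀ m → (∀ {i} → i < m → a i ≈ b i) → a m ≈ b m
  step m a≈b with m ℕₚ.<? s
  ... | yes m<s = trans (a≈0 m m<s) (sym (b≈0 m m<s))
  -- With α = `a s` and d = `a m - b m`, a vanishing slope gives `r × (αʳ d) ≈ 0`; cancel `r`, then
  -- αʳ.
  ... | no  m≮s = x∙y⁻¹≈ε⇒x≈y _ _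
    (x≉0∧xᵏy≈0⇒y≈0 aₛ≉0 r (n×x≈0⇒x≈0 char0 r
      (trans (sym (*-^-slope (a s) (a m - b m) r))
        (trans (*-congˡ slope≈0) (zeroʳ _)))))
    where
    A : Leading a s (a s)
    A = record { below = a≈0 _ ; at = refl }

    B : Leading b s (a s)
    B = record { below = b≈0 _ ; at = sym aₛ≈bₛ }

    -- Take `e = m ∸ s`; the induction hypothesis kills all coefficients below `m`.
    H : Leading (λ n → a n - b n) (s ℕ.+ (m ∸ s)) (a m - b m)
    H = Leading-resp-≡ (≡.sym (ℕₚ.m+[n∸m]≡n (ℕₚ.≮⇒≥ m≮s)))
      (record { below = λ i<m → x≈y⇒x∙y⁻¹≈ε (a≈b i<m) ; at = refl })

    a≈b+[a-b] : ∀ n → a n ≈ b n + (a n - b n)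
    a≈b+[a-b] n = sym (trans (+-comm _ _) (//-rightDividesˡ (b n) (a n)))

    slope≈0 = x≉0∧xy≈0⇒y≈0 gᵣ≉0 (gᵣ*slope≈0 {r = r} g≈0 a≈b+[a-b] A B H ga≈gb)
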